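{- Let $G=(V,E)$ be a finite simple graph and let $\widehat G$ be its associated 2-colored complete graph. Then $G$ is a threshold graph if and only if $\dim \mathcal{A}(\widehat G)=0$.
   Context: A simple graph $G=(V,E)$ is threshold if there are real vertex weights $c(v)$, $v\in V$, such that every pair $\{u,v\}\in\binom{V}{2}$ satisfies $c(u)+c(v)>0$ if $\{u,v\}\in E$ and $c(u)+c(v)<0$ if $\{u,v\}\notin E$. The associated 2-colored graph $\widehat G$ is the complete graph $(V,\binom{V}{2})$ in which a pair is colored red if it is an edge of $G$ and blue otherwise. For a 2-colored graph $H=(V,F)$ (edges colored red/blue), the alternating cone $\mathcal{A}(H)\subseteq\mathbb{R}^F$ is the set of $x\in\mathbb{R}^F$ with $x(e)\ge 0$ for all $e\in F$ and, for every vertex $v$, the sum of $x(e)$ over red edges $e$ incident with $v$ equals the sum of $x(e)$ over blue edges $e$ incident with $v$. -}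

module Defs where

open import Algebra.Bundles.Raw using (RawMonoid)
import Algebra.Definitions.RawMonoid as MonoidSum
open import Data.Empty using (⊥-elim-irr)
open import Data.Fin.Base as Fin using (Fin)
import Data.Fin.Properties as Fin
open import Data.Nat.Base as ℕ using (ℕ)
import Data.Nat.Properties as ℕ
open import Data.Product using (Σ-syntax; ∃-syntax; _×_; _,_)
open import Data.Rational.Base as ℚ using (ℚ; 0ℚ; 1ℚ; ½)
import Data.Rational.Properties as ℚ
open import Data.Rational.Solver using (module +-*-Solver)
open import Level using (0ℓ)
open import Relation.Binary.Core using (Rel)
open import Relation.Binary.Definitions
  using (Decidable; Irreflexive; Symmetric; tri<; tri≈; tri>)
open import Relation.Binary.PropositionalEquality
open import Relation.Nullary using (¬_; ¬?; yes; no)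
open import Relation.Unary using (Pred)

------------------------------------------------------------------------
-- Real numbers: Cauchy sequences of rationals with a modulus, compared by
-- the setoid equality _≃_.

IsCauchy : (ℕ → ℚ) → Set
IsCauchy s = ∀ ε → 0ℚ ℚ.< ε →
  ∃[ N ] (∀ m n → N ℕ.≤ m → N ℕ.≤ n → ℚ.∣ s m ℚ.- s n ∣ ℚ.< ε)

record ℝ : Set where
  constructor mkℝ
  field
    seq    : ℕ → ℚ
    cauchy : IsCauchy seq

open ℝ public

infix 4 _≃_ _≤_ _<_

_≃_ : Rel ℝ 0ℓ
x ≃ y = ∀ ε → 0ℚ ℚ.< ε →
  ∃[ N ] (∀ n → N ℕ.≤ n → ℚ.∣ seq x n ℚ.- seq y n ∣ ℚ.< ε)

_≤_ : Rel ℝ 0ℓ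
x ≤ y = ∀ ε → 0ℚ ℚ.< ε →
  ∃[ N ] (∀ n → N ℕ.≤ n → seq x n ℚ.< seq y n ℚ.+ ε)

-- A uniform positive gap is needed: 0 < 1/n for all n, but the limit is 0.
_<_ : Rel ℝ 0ℓ
x < y = ∃[ ε ] (0ℚ ℚ.< ε) ×
  (∃[ N ] (∀ n → N ℕ.≤ n → seq x n ℚ.+ ε ℚ.< seq y n))

fromℚ : ℚ → ℝ
fromℚ q = mkℝ (λ _ → q) λ ε 0<ε →
  0 , λ _ _ _ _ → subst (ℚ._< ε) (sym (cong ℚ.∣_∣ (ℚ.+-inverseʳ q))) 0<ε

0ℝ : ℝ
0ℝ = fromℚ 0ℚ

+-cauchy : ∀ s t → IsCauchy s → IsCauchy t → IsCauchy (λ n → s n ℚ.+ t n)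
+-cauchy s t cs ct ε 0<ε with cs (½ ℚ.* ε) 0<½ε | ct (½ ℚ.* ε) 0<½ε
  where
  0<½ε : 0ℚ ℚ.< ½ ℚ.* ε
  0<½ε = subst (ℚ._< ½ ℚ.* ε) (ℚ.*-zeroʳ ½) (ℚ.*-monoʳ-<-pos ½ 0<ε)
... | M , hs | N , ht = M ℕ.⊔ N , λ m n p q → begin-strict
  ℚ.∣ (s m ℚ.+ t m) ℚ.- (s n ℚ.+ t n) ∣
    ≡⟨ cong ℚ.∣_∣ (rearrange (s m) (t m) (s n) (t n)) ⟩
  ℚ.∣ (s m ℚ.- s n) ℚ.+ (t m ℚ.- t n) ∣
    ≤⟨ ℚ.∣p+q∣≤∣p∣+∣q∣ (s m ℚ.- s n) (t m ℚ.- t n) ⟩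
  ℚ.∣ s m ℚ.- s n ∣ ℚ.+ ℚ.∣ t m ℚ.- t n ∣
    <⟨ ℚ.+-mono-< (hs m n (ℕ.m⊔n≤o⇒m≤o M N p) (ℕ.m⊔n≤o⇒m≤o M N q))
                  (ht m n (ℕ.m⊔n≤o⇒n≤o M N p) (ℕ.m⊔n≤o⇒n≤o M N q)) ⟩
  ½ ℚ.* ε ℚ.+ ½ ℚ.* ε
    ≡⟨ ℚ.*-distribʳ-+ ε ½ ½ ⟨
  1ℚ ℚ.* ε
    ≡⟨ ℚ.*-identityˡ ε ⟩
  ε ∎
  where
  open ℚ.≤-Reasoning
  rearrange : ∀ a b c d →
    (a ℚ.+ b) ℚ.- (c ℚ.+ d) ≡ (a ℚ.- c) ℚ.+ (b ℚ.- d)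
  rearrange = solve 4 (λ a b c d →
    (a :+ b) :- (c :+ d) := (a :- c) :+ (b :- d)) refl
    where open +-*-Solver

eventually-bounded : ∀ s → IsCauchy s →
  ∃[ K ] ℚ.Positive K × (∃[ N ] (∀ n → N ℕ.≤ n → ℚ.∣ s n ∣ ℚ.≤ K))
eventually-bounded s cs with cs 1ℚ (ℚ.positive⁻¹ 1ℚ)
... | N , h = 1ℚ ℚ.+ ℚ.∣ s N ∣
            , ℚ.pos+nonNeg⇒pos 1ℚ ℚ.∣ s N ∣ {{ℚ.∣-∣-nonNeg (s N)}}
            , N , λ n N≤n → begin
  ℚ.∣ s n ∣
    ≡⟨ cong ℚ.∣_∣ (split (s n) (s N)) ⟩
  ℚ.∣ (s n ℚ.- s N) ℚ.+ s N ∣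
    ≤⟨ ℚ.∣p+q∣≤∣p∣+∣q∣ (s n ℚ.- s N) (s N) ⟩
  ℚ.∣ s n ℚ.- s N ∣ ℚ.+ ℚ.∣ s N ∣
    ≤⟨ ℚ.+-monoˡ-≤ ℚ.∣ s N ∣ (ℚ.<⇒≤ (h n N N≤n ℕ.≤-refl)) ⟩
  1ℚ ℚ.+ ℚ.∣ s N ∣ ∎
  where
  open ℚ.≤-Reasoning
  split : ∀ a b → a ≡ (a ℚ.- b) ℚ.+ b
  split = solve 2 (λ a b → a := (a :- b) :+ b) refl
    where open +-*-Solver

divideℚ : ∀ M → ℚ.Positive M → ∀ ε → 0ℚ ℚ.< ε →
  ∃[ δ ] (0ℚ ℚ.< δ) × M ℚ.* δ ≡ ε
divideℚ M M>0 ε 0<ε = M⁻¹ ℚ.* ε , 0<M⁻¹ε , (begin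
  M ℚ.* (M⁻¹ ℚ.* ε)  ≡⟨ ℚ.*-assoc M M⁻¹ ε ⟨
  (M ℚ.* M⁻¹) ℚ.* ε  ≡⟨ cong (ℚ._* ε) (ℚ.*-inverseʳ M {{M≢0}}) ⟩
  1ℚ ℚ.* ε           ≡⟨ ℚ.*-identityˡ ε ⟩
  ε                  ∎)
  where
  open ≡-Reasoning
  M≢0 : ℚ.NonZero M
  M≢0 = ℚ.pos⇒nonZero M {{M>0}}
  M⁻¹ : ℚ
  M⁻¹ = ℚ.1/_ M {{M≢0}}
  0<M⁻¹ε : 0ℚ ℚ.< M⁻¹ ℚ.* ε
  0<M⁻¹ε = subst (ℚ._< M⁻¹ ℚ.* ε) (ℚ.*-zeroʳ M⁻¹)
    (ℚ.*-monoʳ-<-pos M⁻¹ {{ℚ.1/pos⇒pos M {{M>0}}}} 0<ε)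

∣*∣-bound : ∀ a b M δ → ℚ.Positive M →
  ℚ.∣ a ∣ ℚ.≤ M → ℚ.∣ b ∣ ℚ.< δ → ℚ.∣ a ℚ.* b ∣ ℚ.< M ℚ.* δ
∣*∣-bound a b M δ M>0 a≤M b<δ = begin-strict
  ℚ.∣ a ℚ.* b ∣
    ≡⟨ ℚ.∣p*q∣≡∣p∣*∣q∣ a b ⟩
  ℚ.∣ a ∣ ℚ.* ℚ.∣ b ∣
    ≤⟨ ℚ.*-monoʳ-≤-nonNeg ℚ.∣ b ∣ {{ℚ.∣-∣-nonNeg b}} a≤M ⟩
  M ℚ.* ℚ.∣ b ∣
    <⟨ ℚ.*-monoʳ-<-pos M {{M>0}} b<δ ⟩
  M ℚ.* δ ∎
  where open ℚ.≤-Reasoning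

*-close : ∀ a b c d K L δ → ℚ.Positive K → ℚ.Positive L →
  ℚ.∣ a ∣ ℚ.≤ K → ℚ.∣ d ∣ ℚ.≤ L →
  ℚ.∣ a ℚ.- c ∣ ℚ.< δ → ℚ.∣ b ℚ.- d ∣ ℚ.< δ →
  ℚ.∣ a ℚ.* b ℚ.- c ℚ.* d ∣ ℚ.< (K ℚ.+ L) ℚ.* δ
*-close a b c d K L δ K>0 L>0 a≤K d≤L a-c<δ b-d<δ = begin-strict
  ℚ.∣ a ℚ.* b ℚ.- c ℚ.* d ∣
    ≡⟨ cong ℚ.∣_∣ (rearrange a b c d) ⟩
  ℚ.∣ a ℚ.* (b ℚ.- d) ℚ.+ d ℚ.* (a ℚ.- c) ∣
    ≤⟨ ℚ.∣p+q∣≤∣p∣+∣q∣ (a ℚ.* (b ℚ.- d)) (d ℚ.* (a ℚ.- c)) ⟩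
  ℚ.∣ a ℚ.* (b ℚ.- d) ∣ ℚ.+ ℚ.∣ d ℚ.* (a ℚ.- c) ∣
    <⟨ ℚ.+-mono-< (∣*∣-bound a (b ℚ.- d) K δ K>0 a≤K b-d<δ)
                  (∣*∣-bound d (a ℚ.- c) L δ L>0 d≤L a-c<δ) ⟩
  K ℚ.* δ ℚ.+ L ℚ.* δ
    ≡⟨ ℚ.*-distribʳ-+ δ K L ⟨
  (K ℚ.+ L) ℚ.* δ ∎
  where
  open ℚ.≤-Reasoning
  rearrange : ∀ a b c d →
    a ℚ.* b ℚ.- c ℚ.* d ≡ a ℚ.* (b ℚ.- d) ℚ.+ d ℚ.* (a ℚ.- c)
  rearrange = solve 4 (λ a b c d →
    a :* b :- c :* d := a :* (b :- d) :+ d :* (a :- c)) refl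
    where open +-*-Solver

*-cauchy : ∀ s t → IsCauchy s → IsCauchy t → IsCauchy (λ n → s n ℚ.* t n)
*-cauchy s t cs ct ε 0<ε =
  let K , K>0 , A , s≤K = eventually-bounded s cs
      L , L>0 , B , t≤L = eventually-bounded t ct
      δ , 0<δ , eq = divideℚ (K ℚ.+ L) (ℚ.pos+pos⇒pos K {{K>0}} L {{L>0}}) ε 0<ε
      C , hs = cs δ 0<δ
      D , ht = ct δ 0<δ
  in combine K L δ A B C D K>0 L>0 s≤K t≤L eq hs ht
  where
  combine : ∀ K L δ A B C D → ℚ.Positive K → ℚ.Positive L →
    (∀ n → A ℕ.≤ n → ℚ.∣ s n ∣ ℚ.≤ K) →
    (∀ n → B ℕ.≤ n → ℚ.∣ t n ∣ ℚ.≤ L) →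
    (K ℚ.+ L) ℚ.* δ ≡ ε →
    (∀ m n → C ℕ.≤ m → C ℕ.≤ n → ℚ.∣ s m ℚ.- s n ∣ ℚ.< δ) →
    (∀ m n → D ℕ.≤ m → D ℕ.≤ n → ℚ.∣ t m ℚ.- t n ∣ ℚ.< δ) →
    ∃[ N ] (∀ m n → N ℕ.≤ m → N ℕ.≤ n →
      ℚ.∣ s m ℚ.* t m ℚ.- s n ℚ.* t n ∣ ℚ.< ε)
  combine K L δ A B C D K>0 L>0 s≤K t≤L eq hs ht =
    (A ℕ.⊔ B) ℕ.⊔ (C ℕ.⊔ D) , λ m n p q →
    subst (ℚ.∣ s m ℚ.* t m ℚ.- s n ℚ.* t n ∣ ℚ.<_) eq
      (*-close (s m) (t m) (s n) (t n) K L δ K>0 L>0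
        (s≤K m (ℕ.m⊔n≤o⇒m≤o A B (left p)))
        (t≤L n (ℕ.m⊔n≤o⇒n≤o A B (left q)))
        (hs m n (ℕ.m⊔n≤o⇒m≤o C D (right p)) (ℕ.m⊔n≤o⇒m≤o C D (right q)))
        (ht m n (ℕ.m⊔n≤o⇒n≤o C D (right p)) (ℕ.m⊔n≤o⇒n≤o C D (right q))))
    where
    left : ∀ {k} → (A ℕ.⊔ B) ℕ.⊔ (C ℕ.⊔ D) ℕ.≤ k → A ℕ.⊔ B ℕ.≤ k
    left = ℕ.m⊔n≤o⇒m≤o (A ℕ.⊔ B) (C ℕ.⊔ D)
    right : ∀ {k} → (A ℕ.⊔ B) ℕ.⊔ (C ℕ.⊔ D) ℕ.≤ k → C ℕ.⊔ D ℕ.≤ k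
    right = ℕ.m⊔n≤o⇒n≤o (A ℕ.⊔ B) (C ℕ.⊔ D)

infixl 6 _+_
infixl 7 _*_

_+_ : ℝ → ℝ → ℝ
x + y = mkℝ (λ n → seq x n ℚ.+ seq y n)
            (+-cauchy (seq x) (seq y) (cauchy x) (cauchy y))

_*_ : ℝ → ℝ → ℝ
x * y = mkℝ (λ n → seq x n ℚ.* seq y n)
            (*-cauchy (seq x) (seq y) (cauchy x) (cauchy y))

+-rawMonoid : RawMonoid 0ℓ 0ℓ
+-rawMonoid = record { Carrier = ℝ ; _≈_ = _≃_ ; _∙_ = _+_ ; ε = 0ℝ }

open MonoidSum +-rawMonoid public using (sum)

------------------------------------------------------------------------
-- Linear algebra in ℝ^I

ℝ^_ : Set → Set
ℝ^ I = I → ℝ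

module _ {I : Set} where

  infix 4 _≋_

  _≋_ : Rel (ℝ^ I) 0ℓ
  x ≋ y = ∀ i → x i ≃ y i

  0ᵛ : ℝ^ I
  0ᵛ _ = 0ℝ

  lincomb : ∀ {k} → (Fin k → ℝ) → (Fin k → ℝ^ I) → ℝ^ I
  lincomb a b i = sum (λ j → a j * b j i)

  Span : Pred (ℝ^ I) 0ℓ → Pred (ℝ^ I) 0ℓ
  Span S x = ∃[ k ] Σ[ a ∈ (Fin k → ℝ) ] Σ[ s ∈ (Fin k → ℝ^ I) ]
    (∀ j → S (s j)) × x ≋ lincomb a s

  LinearlyIndependent : ∀ {k} → (Fin k → ℝ^ I) → Set
  LinearlyIndependent b = ∀ a → lincomb a b ≋ 0ᵛ → ∀ j → a j ≃ 0ℝ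

  IsBasisOf : ∀ {k} → Pred (ℝ^ I) 0ℓ → (Fin k → ℝ^ I) → Set
  IsBasisOf W b =
    (∀ j → W (b j)) ×
    LinearlyIndependent b ×
    (∀ x → W x → ∃[ a ] x ≋ lincomb a b)

  -- The dimension of a convex cone is that of its linear span, which is also
  -- its affine hull because the cone contains the origin.
  ConeDimension : Pred (ℝ^ I) 0ℓ → ℕ → Set
  ConeDimension C d = Σ[ b ∈ (Fin d → ℝ^ I) ] IsBasisOf (Span C) b

------------------------------------------------------------------------
-- Graphs

-- Decidability of adjacency is automatic classically for a finite graph;
-- here it is what allows edges to be coloured and summed over.
record SimpleGraph (n : ℕ) : Set₁ where
  infix 4 _∼_ _∼?_
  field
    _∼_      : Rel (Fin n) 0ℓ
    _∼?_     : Decidable _∼_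
    ∼-sym    : Symmetric _∼_
    ∼-irrefl : Irreflexive _≡_ _∼_

module _ {n : ℕ} (G : SimpleGraph n) where
  open SimpleGraph G

  -- An unordered pair is listed once, smaller endpoint first; the proof
  -- fields are irrelevant, so an edge is determined by its endpoints.
  record Edge : Set where
    constructor edge
    field
      lo hi     : Fin n
      .lo<hi    : lo Fin.< hi
      .adjacent : lo ∼ hi

  joining : ∀ u v → .(u ∼ v) → Edge
  joining u v u∼v with Fin.<-cmp u v
  ... | tri< u<v _ _ = edge u v u<v u∼v
  ... | tri≈ _ u≡v _ = loop u≡v u∼v
    where
    loop : u ≡ v → .(u ∼ v) → Edge
    loop u≡v u∼v = ⊥-elim-irr (∼-irrefl u≡v u∼v)
  ... | tri> _ _ v<u = edge v u v<u (∼-sym u∼v)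

  IsThreshold : Set
  IsThreshold = Σ[ c ∈ (Fin n → ℝ) ] (∀ u v → u ≢ v →
    (u ∼ v → 0ℝ < c u + c v) × (¬ u ∼ v → c u + c v < 0ℝ))

data Colour : Set where
  red blue : Colour

keepIf : Colour → Colour → ℝ → ℝ
keepIf red  red  r = r
keepIf blue blue r = r
keepIf red  blue _ = 0ℝ
keepIf blue red  _ = 0ℝ

record TwoColouredGraph (n : ℕ) : Set₁ where
  field
    graph  : SimpleGraph n
    colour : Edge graph → Colour

module _ {n : ℕ} (H : TwoColouredGraph n) where
  open TwoColouredGraph H
  open SimpleGraph graph

  colouredValue : Colour → ℝ^ (Edge graph) → Fin n → Fin n → ℝ
  colouredValue κ x v u with v ∼? u
  ... | yes v∼u = keepIf κ (colour e) (x e)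
    where e = joining graph v u v∼u
  ... | no  _   = 0ℝ

  -- The edges incident with v correspond to the neighbours u of v.
  colourSum : Colour → ℝ^ (Edge graph) → Fin n → ℝ
  colourSum κ x v = sum (colouredValue κ x v)

  AlternatingCone : Pred (ℝ^ (Edge graph)) 0ℓ
  AlternatingCone x =
    (∀ e → 0ℝ ≤ x e) × (∀ v → colourSum red x v ≃ colourSum blue x v)

complete : ∀ n → SimpleGraph n
complete n = record
  { _∼_      = _≢_
  ; _∼?_     = λ u v → ¬? (u Fin.≟ v)
  ; ∼-sym    = ≢-sym
  ; ∼-irrefl = λ u≡v u≢v → u≢v u≡v
  }

adjacencyColour : ∀ {n} → SimpleGraph n → Edge (complete n) → Colour
adjacencyColour G (edge u v _ _) with SimpleGraph._∼?_ G u v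
... | yes _ = red
... | no  _ = blue

associated : ∀ {n} → SimpleGraph n → TwoColouredGraph n
associated {n} G = record { graph = complete n ; colour = adjacencyColour G }

{-# OPTIONS --safe #-}
module Submission where

-- Dimension zero means that the cone is trivial. If c are threshold weights and
-- x is in the cone, weighting the balance condition at v by c(v) and summing
-- gives 0 = Σ |c(u) + c(v)| x(uv), so x vanishes; since the weights are finitely
-- many and the inequalities strict, they may be taken rational.
--
-- Conversely, an alternating 4-cycle a ∼ b ≁ c ∼ d ≁ a has its characteristic
-- vector in the cone. Without one, deg u < deg w whenever some v ≢ u is adjacent
-- to w but not to u. Hence with t(v) one more than the largest degree of a
-- non-neighbour of v, distinct u, v satisfy t(v) ≤ deg u if they are adjacent
-- and deg u + 1 ≤ t(v) if not, so c(v) = deg v − t(v) + ½ are threshold weights.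

open import Defs
open import Algebra.Bundles using (CommutativeRing)
import Algebra.Properties.Semiring.Sum as SemiringSum
open import Data.Bool.Base using (if_then_else_)
open import Data.Empty using (⊥-elim-irr)
open import Data.Fin.Base as Fin using (Fin; zero; suc)
import Data.Fin.Properties as Fin
open import Data.Nat.Base as ℕ using (ℕ)
import Data.Nat.Properties as ℕ
open import Data.Product using (_×_; _,_; proj₁; proj₂; ∃-syntax)
open import Data.Rational.Base as ℚ using (ℚ; 0ℚ; 1ℚ; ½)
import Data.Rational.Properties as ℚ
open import Data.Rational.Solver using (module +-*-Solver)
open import Data.Sum.Base using (inj₁; inj₂)
open import Function.Base using (_∘_)
open import Function.Bundles using (_⇔_; mk⇔)
open import Relation.Binary.Definitions using (tri<; tri≈; tri>)
open import Relation.Binary.PropositionalEquality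
open import Relation.Nullary using (Dec; ¬_; ¬?; _×-dec_; yes; no; does; contradiction)
open import Relation.Nullary.Decidable using (dec-true; dec-false; from-yes)

open SemiringSum (CommutativeRing.semiring ℚ.+-*-commutativeRing)
  using (∑-distrib-+; ∑-comm; *-distribˡ-sum; *-distribʳ-sum; sum-cong-≗)
  renaming (sum to ∑)
open +-*-Solver

private variable
  n : ℕ
  P : Set
  p q : ℚ

-- Order on the rationals

p≤p+q : 0ℚ ℚ.≤ q → p ℚ.≤ p ℚ.+ q
p≤p+q {q} {p} 0≤q = subst (ℚ._≤ p ℚ.+ q) (ℚ.+-identityʳ p) (ℚ.+-monoʳ-≤ p 0≤q)

p≤q+p : 0ℚ ℚ.≤ q → p ℚ.≤ q ℚ.+ p
p≤q+p {q} {p} 0≤q = subst (p ℚ.≤_) (ℚ.+-comm p q) (p≤p+q 0≤q)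

0≤p+q : 0ℚ ℚ.≤ p → 0ℚ ℚ.≤ q → 0ℚ ℚ.≤ p ℚ.+ q
0≤p+q 0≤p 0≤q = ℚ.≤-trans 0≤p (p≤p+q 0≤q)

0≤p*q : 0ℚ ℚ.≤ p → 0ℚ ℚ.≤ q → 0ℚ ℚ.≤ p ℚ.* q
0≤p*q {p} {q} 0≤p 0≤q = subst (ℚ._≤ p ℚ.* q) (ℚ.*-zeroʳ p)
  (ℚ.*-monoˡ-≤-nonNeg p {{ℚ.nonNegative 0≤p}} 0≤q)

0<p*q : 0ℚ ℚ.< p → 0ℚ ℚ.< q → 0ℚ ℚ.< p ℚ.* q
0<p*q {p} {q} 0<p 0<q = subst (ℚ._< p ℚ.* q) (ℚ.*-zeroʳ p)
  (ℚ.*-monoʳ-<-pos p {{ℚ.positive 0<p}} 0<q)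

p≤∣p∣ : ∀ p → p ℚ.≤ ℚ.∣ p ∣
p≤∣p∣ p with ℚ.≤-total 0ℚ p
... | inj₁ 0≤p = ℚ.≤-reflexive (sym (ℚ.0≤p⇒∣p∣≡p 0≤p))
... | inj₂ p≤0 = ℚ.≤-trans p≤0 (ℚ.0≤∣p∣ p)

∣p∣<q : ℚ.- q ℚ.< p → p ℚ.< q → ℚ.∣ p ∣ ℚ.< q
∣p∣<q {q} {p} -q<p p<q with ℚ.∣p∣≡p∨∣p∣≡-p p
... | inj₁ eq = subst (ℚ._< q) (sym eq) p<q
... | inj₂ eq = subst₂ ℚ._<_ (sym eq) (solve 1 (λ a → :- (:- a) := a) refl q) (ℚ.neg-antimono-< -q<p)

-- Finite sums of rationals

∑-mono-≤ : {f g : Fin n → ℚ} → (∀ i → f i ℚ.≤ g i) → ∑ f ℚ.≤ ∑ g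
∑-mono-≤ {ℕ.zero}  f≤g = ℚ.≤-refl
∑-mono-≤ {ℕ.suc n} f≤g = ℚ.+-mono-≤ (f≤g zero) (∑-mono-≤ (f≤g ∘ suc))

∑-mono-gap : {f g : Fin n → ℚ} → (∀ i → f i ℚ.≤ g i) →
  ∀ i ε → ε ℚ.+ f i ℚ.≤ g i → ε ℚ.+ ∑ f ℚ.≤ ∑ g
∑-mono-gap {ℕ.suc n} {f} {g} f≤g zero ε gap = begin
  ε ℚ.+ (f zero ℚ.+ ∑ (f ∘ suc)) ≡⟨ ℚ.+-assoc ε _ _ ⟨
  (ε ℚ.+ f zero) ℚ.+ ∑ (f ∘ suc) ≤⟨ ℚ.+-mono-≤ gap (∑-mono-≤ (f≤g ∘ suc)) ⟩
  g zero ℚ.+ ∑ (g ∘ suc)         ∎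
  where open ℚ.≤-Reasoning
∑-mono-gap {ℕ.suc n} {f} {g} f≤g (suc i) ε gap = begin
  ε ℚ.+ (f zero ℚ.+ ∑ (f ∘ suc)) ≡⟨ solve 3 (λ a b c → a :+ (b :+ c) := b :+ (a :+ c)) refl ε (f zero) (∑ (f ∘ suc)) ⟩
  f zero ℚ.+ (ε ℚ.+ ∑ (f ∘ suc)) ≤⟨ ℚ.+-mono-≤ (f≤g zero) (∑-mono-gap (f≤g ∘ suc) i ε gap) ⟩
  g zero ℚ.+ ∑ (g ∘ suc)         ∎
  where open ℚ.≤-Reasoning

∑-zero : {f : Fin n → ℚ} → (∀ i → f i ≡ 0ℚ) → ∑ f ≡ 0ℚ
∑-zero {ℕ.zero}  f≡0 = refl
∑-zero {ℕ.suc n} f≡0 = cong₂ ℚ._+_ (f≡0 zero) (∑-zero (f≡0 ∘ suc))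

0≤∑ : {f : Fin n → ℚ} → (∀ i → 0ℚ ℚ.≤ f i) → 0ℚ ℚ.≤ ∑ f
0≤∑ {n} {f} 0≤f = subst (ℚ._≤ ∑ f) (∑-zero {n} (λ _ → refl)) (∑-mono-≤ 0≤f)

-- This is `∑-mono-gap` with the zero function below `f` and the gap `f i` at position `i`.
term≤∑ : {f : Fin n → ℚ} → (∀ i → 0ℚ ℚ.≤ f i) → ∀ i → f i ℚ.≤ ∑ f
term≤∑ {n} {f} 0≤f i = subst (ℚ._≤ ∑ f)
  (trans (cong (f i ℚ.+_) (∑-zero {n} (λ _ → refl))) (ℚ.+-identityʳ (f i)))
  (∑-mono-gap 0≤f i (f i) (ℚ.≤-reflexive (ℚ.+-identityʳ (f i))))

-- The witness is the maximum of 0 and the values of `f`, so that the empty family has one too; this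
-- is why leastness ranges over nonnegative bounds.
supremum : (f : Fin n → ℚ) → ∃[ s ]
  (∀ i → f i ℚ.≤ s) × (∀ {b} → 0ℚ ℚ.≤ b → (∀ i → f i ℚ.≤ b) → s ℚ.≤ b)
supremum {ℕ.zero}  f = 0ℚ , (λ ()) , λ 0≤b _ → 0≤b
supremum {ℕ.suc n} f with supremum (f ∘ suc)
... | s , ub , least = f zero ℚ.⊔ s
    , (λ { zero    → ℚ.p≤p⊔q (f zero) s
         ; (suc i) → ℚ.≤-trans (ub i) (ℚ.p≤q⊔p (f zero) s) })
    , λ 0≤b f≤b → ℚ.⊔-lub (f≤b zero) (least 0≤b (f≤b ∘ suc))

-- Indicators

-- Only `does` is inspected, so `δ (suc i) (suc j)` computes to `δ i j`; the induction in `∑-δ`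
-- relies on this.
𝟙 : Dec P → ℚ
𝟙 P? = if does P? then 1ℚ else 0ℚ

𝟙-true : (P? : Dec P) → P → 𝟙 P? ≡ 1ℚ
𝟙-true P? p = cong (if_then 1ℚ else 0ℚ) (dec-true P? p)

𝟙-false : (P? : Dec P) → ¬ P → 𝟙 P? ≡ 0ℚ
𝟙-false P? ¬p = cong (if_then 1ℚ else 0ℚ) (dec-false P? ¬p)

0≤1 : 0ℚ ℚ.≤ 1ℚ
0≤1 = ℚ.nonNegative⁻¹ 1ℚ

0≤𝟙 : (P? : Dec P) → 0ℚ ℚ.≤ 𝟙 P?
0≤𝟙 (yes _) = 0≤1
0≤𝟙 (no _)  = ℚ.≤-refl

𝟙-mono : ∀ {Q : Set} (P? : Dec P) (Q? : Dec Q) → (P → Q) → 𝟙 P? ℚ.≤ 𝟙 Q?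
𝟙-mono (no _)  Q? _   = 0≤𝟙 Q?
𝟙-mono (yes p) Q? P⇒Q = ℚ.≤-reflexive (sym (𝟙-true Q? (P⇒Q p)))

𝟙-cong : ∀ {Q : Set} (P? : Dec P) (Q? : Dec Q) → (P → Q) → (Q → P) → 𝟙 P? ≡ 𝟙 Q?
𝟙-cong P? Q? P⇒Q Q⇒P = ℚ.≤-antisym (𝟙-mono P? Q? P⇒Q) (𝟙-mono Q? P? Q⇒P)

δ : Fin n → Fin n → ℚ
δ i j = 𝟙 (i Fin.≟ j)

δ-refl : (i : Fin n) → δ i i ≡ 1ℚ
δ-refl i = 𝟙-true (i Fin.≟ i) refl

δ-≢ : {i j : Fin n} → i ≢ j → δ i j ≡ 0ℚ
δ-≢ {i = i} {j} = 𝟙-false (i Fin.≟ j)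

∑-δ : (i : Fin n) (f : Fin n → ℚ) → ∑ (λ j → δ i j ℚ.* f j) ≡ f i
∑-δ zero    f = begin
  1ℚ ℚ.* f zero ℚ.+ ∑ (λ j → 0ℚ ℚ.* f (suc j))
    ≡⟨ cong₂ ℚ._+_ (ℚ.*-identityˡ (f zero)) (∑-zero λ j → ℚ.*-zeroˡ (f (suc j))) ⟩
  f zero ℚ.+ 0ℚ
    ≡⟨ ℚ.+-identityʳ _ ⟩
  f zero ∎
  where open ≡-Reasoning
∑-δ (suc i) f = begin
  0ℚ ℚ.* f zero ℚ.+ ∑ (λ j → δ i j ℚ.* f (suc j))
    ≡⟨ cong₂ ℚ._+_ (ℚ.*-zeroˡ (f zero)) (∑-δ i (f ∘ suc)) ⟩
  0ℚ ℚ.+ f (suc i)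
    ≡⟨ ℚ.+-identityˡ _ ⟩
  f (suc i) ∎
  where open ≡-Reasoning

-- Eventual properties of sequences and null reals

Eventually : (ℕ → Set) → Set
Eventually Q = ∃[ N ] (∀ k → N ℕ.≤ k → Q k)

eventually-map : {Q R : ℕ → Set} → (∀ k → Q k → R k) → Eventually Q → Eventually R
eventually-map Q⇒R (N , h) = N , λ k N≤k → Q⇒R k (h k N≤k)

eventually-× : {Q R : ℕ → Set} → Eventually Q → Eventually R → Eventually (λ k → Q k × R k)
eventually-× (M , h) (N , h′) = M ℕ.⊔ N , λ k M⊔N≤k →
  h k (ℕ.m⊔n≤o⇒m≤o M N M⊔N≤k) , h′ k (ℕ.m⊔n≤o⇒n≤o M N M⊔N≤k)

-- Finitely many starting indices have a maximum. This brings the conditions at all vertices and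
-- pairs to one common index, where the argument is about rationals.
eventually-∀ : {Q : Fin n → ℕ → Set} → (∀ i → Eventually (Q i)) → Eventually (λ k → ∀ i → Q i k)
eventually-∀ {ℕ.zero}  h = 0 , λ _ _ ()
eventually-∀ {ℕ.suc n} h = eventually-map
  (λ { k (q , qs) zero → q ; k (q , qs) (suc i) → qs i })
  (eventually-× (h zero) (eventually-∀ (h ∘ suc)))

≗⇒≃ : ∀ x y → (∀ k → seq x k ≡ seq y k) → x ≃ y
≗⇒≃ x y eq ε 0<ε = 0 , λ k _ →
  subst (ℚ._< ε) (sym (cong ℚ.∣_∣ (trans (cong (ℚ._- seq y k) (eq k)) (ℚ.+-inverseʳ (seq y k))))) 0<ε

half : ∀ {ε} → 0ℚ ℚ.< ε → 0ℚ ℚ.< ½ ℚ.* ε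
half 0<ε = 0<p*q (ℚ.positive⁻¹ ½) 0<ε

half+half : ∀ ε → ½ ℚ.* ε ℚ.+ ½ ℚ.* ε ≡ ε
half+half ε = trans (sym (ℚ.*-distribʳ-+ ε ½ ½)) (ℚ.*-identityˡ ε)

∣∣-split-< : ∀ a b {c ε} → c ≡ a ℚ.+ b → ℚ.∣ a ∣ ℚ.< ½ ℚ.* ε → ℚ.∣ b ∣ ℚ.< ½ ℚ.* ε → ℚ.∣ c ∣ ℚ.< ε
∣∣-split-< a b {ε = ε} refl a< b< = begin-strict
  ℚ.∣ a ℚ.+ b ∣           ≤⟨ ℚ.∣p+q∣≤∣p∣+∣q∣ a b ⟩
  ℚ.∣ a ∣ ℚ.+ ℚ.∣ b ∣     <⟨ ℚ.+-mono-< a< b< ⟩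
  ½ ℚ.* ε ℚ.+ ½ ℚ.* ε     ≡⟨ half+half ε ⟩
  ε                       ∎
  where open ℚ.≤-Reasoning

≃-trans : ∀ x y z → x ≃ y → y ≃ z → x ≃ z
≃-trans x y z x≃y y≃z ε 0<ε = eventually-map
  (λ k (p , q) → ∣∣-split-< (seq x k ℚ.- seq y k) (seq y k ℚ.- seq z k)
    (solve 3 (λ a b c → a :- c := (a :- b) :+ (b :- c)) refl (seq x k) (seq y k) (seq z k)) p q)
  (eventually-× (x≃y _ (half 0<ε)) (y≃z _ (half 0<ε)))

Null : ℝ → Set
Null x = x ≃ 0ℝ

+-null : ∀ x y → Null x → Null y → Null (x + y)
+-null x y x≃0 y≃0 ε 0<ε = eventually-map
  (λ k (p , q) → ∣∣-split-< (seq x k ℚ.- 0ℚ) (seq y k ℚ.- 0ℚ)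
    (solve 2 (λ a b → (a :+ b) :- con 0ℚ := (a :- con 0ℚ) :+ (b :- con 0ℚ)) refl (seq x k) (seq y k)) p q)
  (eventually-× (x≃0 _ (half 0<ε)) (y≃0 _ (half 0<ε)))

-- Since `x` is eventually bounded by some `K`, it is enough that `y` falls below `ε` divided by
-- `K`.
*-nullʳ : ∀ x y → Null y → Null (x * y)
*-nullʳ x y y≃0 ε 0<ε =
  let K , K>0 , bounded = eventually-bounded (seq x) (cauchy x)
      η , 0<η , Kη≡ε = divideℚ K K>0 ε 0<ε
  in eventually-map
    (λ k (x≤K , y<η) → subst₂ ℚ._<_
      (cong ℚ.∣_∣ (solve 2 (λ a b → a :* (b :- con 0ℚ) := a :* b :- con 0ℚ) refl (seq x k) (seq y k)))
      Kη≡ε (∣*∣-bound (seq x k) (seq y k ℚ.- 0ℚ) K η K>0 x≤K y<η))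
    (eventually-× bounded (y≃0 η 0<η))

fromℚ-null⇒< : ∀ q → Null (fromℚ q) → ∀ {ε} → 0ℚ ℚ.< ε → q ℚ.< ε
fromℚ-null⇒< q q≃0 {ε} 0<ε =
  let N , h = q≃0 ε 0<ε
  in ℚ.≤-<-trans (p≤∣p∣ q) (subst (ℚ._< ε) (cong ℚ.∣_∣ (ℚ.+-identityʳ q)) (h N ℕ.≤-refl))

sum-null : (x : Fin n → ℝ) → (∀ i → Null (x i)) → Null (sum x)
sum-null {ℕ.zero}  x x≃0 = ≗⇒≃ 0ℝ 0ℝ (λ _ → refl)
sum-null {ℕ.suc n} x x≃0 = +-null (x zero) (sum (x ∘ suc)) (x≃0 zero) (sum-null (x ∘ suc) (x≃0 ∘ suc))

seq-sum : (x : Fin n → ℝ) → ∀ k → seq (sum x) k ≡ ∑ (λ i → seq (x i) k)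
seq-sum {ℕ.zero}  x k = refl
seq-sum {ℕ.suc n} x k = cong (seq (x zero) k ℚ.+_) (seq-sum (x ∘ suc) k)

-- Cones of dimension zero

module _ {I : Set} {C : ℝ^ I → Set} where

  -- Combinations of null vectors are null, so the span is trivial and the empty family is a basis
  -- of it.
  null⇒dimension-zero : (∀ x → C x → x ≋ 0ᵛ) → ConeDimension C 0
  null⇒dimension-zero null = (λ ()) , (λ ()) , (λ _ _ ()) ,
    λ x (_ , a , s , Cs , x≋) → (λ ()) , λ i →
      ≃-trans (x i) (lincomb a s i) 0ℝ (x≋ i) (sum-null _ λ j → *-nullʳ (a j) (s j i) (null (s j) (Cs j) i))

  -- A member `x` lies in the span as itself with coefficient 1, and a combination of the empty
  -- basis computes to `0ᵛ`.
  dimension-zero⇒null : ConeDimension C 0 → ∀ x → C x → x ≋ 0ᵛ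
  dimension-zero⇒null (_ , _ , _ , spans) x Cx =
    proj₂ (spans x (1 , (λ _ → fromℚ 1ℚ) , (λ _ → x) , (λ _ → Cx) , λ i →
      ≗⇒≃ (x i) (fromℚ 1ℚ * x i + 0ℝ) λ k →
        sym (trans (ℚ.+-identityʳ _) (ℚ.*-identityˡ (seq (x i) k)))))

-- A weighted double count

-- The half weighted by `c u` turns into the half weighted by `c v` on exchanging the summations and
-- using the symmetry of `F`. The row sums on the right are what the balance condition controls.
∑-weights-swap : (c : Fin n → ℚ) (F : Fin n → Fin n → ℚ) → (∀ v u → F v u ≡ F u v) →
  ∑ (λ v → ∑ λ u → (c v ℚ.+ c u) ℚ.* F v u) ≡ ∑ (λ v → c v ℚ.* ∑ (F v)) ℚ.+ ∑ (λ v → c v ℚ.* ∑ (F v))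
∑-weights-swap c F F-sym = begin
  ∑ (λ v → ∑ λ u → (c v ℚ.+ c u) ℚ.* F v u)
    ≡⟨ sum-cong-≗ (λ v → trans (sum-cong-≗ λ u → ℚ.*-distribʳ-+ (F v u) (c v) (c u))
         (∑-distrib-+ (λ u → c v ℚ.* F v u) (λ u → c u ℚ.* F v u))) ⟩
  ∑ (λ v → ∑ (λ u → c v ℚ.* F v u) ℚ.+ ∑ (λ u → c u ℚ.* F v u))
    ≡⟨ ∑-distrib-+ (λ v → ∑ λ u → c v ℚ.* F v u) (λ v → ∑ λ u → c u ℚ.* F v u) ⟩
  ∑ (λ v → ∑ λ u → c v ℚ.* F v u) ℚ.+ ∑ (λ v → ∑ λ u → c u ℚ.* F v u)
    ≡⟨ cong₂ ℚ._+_ factor (trans (∑-comm (λ v u → c u ℚ.* F v u))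
         (trans (sum-cong-≗ λ u → sum-cong-≗ λ v → cong (c u ℚ.*_) (F-sym v u)) factor)) ⟩
  ∑ (λ v → c v ℚ.* ∑ (F v)) ℚ.+ ∑ (λ v → c v ℚ.* ∑ (F v)) ∎
  where
  open ≡-Reasoning
  factor : ∑ (λ v → ∑ λ u → c v ℚ.* F v u) ≡ ∑ (λ v → c v ℚ.* ∑ (F v))
  factor = sum-cong-≗ λ v → sym (*-distribˡ-sum (c v) (F v))

∑-weighted-bound : (c d : Fin n → ℚ) (η : ℚ) → (∀ v → ℚ.∣ d v ∣ ℚ.≤ η) →
  ∑ (λ v → c v ℚ.* d v) ℚ.≤ ∑ (λ v → ℚ.∣ c v ∣) ℚ.* η
∑-weighted-bound c d η d≤η = begin
  ∑ (λ v → c v ℚ.* d v)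
    ≤⟨ ∑-mono-≤ (λ v → begin
         c v ℚ.* d v              ≤⟨ p≤∣p∣ (c v ℚ.* d v) ⟩
         ℚ.∣ c v ℚ.* d v ∣        ≡⟨ ℚ.∣p*q∣≡∣p∣*∣q∣ (c v) (d v) ⟩
         ℚ.∣ c v ∣ ℚ.* ℚ.∣ d v ∣  ≤⟨ ℚ.*-monoˡ-≤-nonNeg ℚ.∣ c v ∣ {{ℚ.∣-∣-nonNeg (c v)}} (d≤η v) ⟩
         ℚ.∣ c v ∣ ℚ.* η          ∎) ⟩
  ∑ (λ v → ℚ.∣ c v ∣ ℚ.* η)
    ≡⟨ *-distribʳ-sum η (λ v → ℚ.∣ c v ∣) ⟨
  ∑ (λ v → ℚ.∣ c v ∣) ℚ.* η ∎
  where open ℚ.≤-Reasoning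

-- c is a potential on the vertices whose sums agree in sign with S. The bound
-- is for a symmetric weighting X that is almost nonnegative and almost balanced.
module Potential
  (c : Fin n → ℚ) (S : Fin n → Fin n → ℚ)
  (S-sym : ∀ v u → S v u ≡ S u v)
  (weight≥0 : ∀ v u → 0ℚ ℚ.≤ (c v ℚ.+ c u) ℚ.* S v u)
  where

  private
    weight : Fin n → Fin n → ℚ
    weight v u = (c v ℚ.+ c u) ℚ.* S v u

    K : ℚ
    K = ∑ (λ v → ℚ.∣ c v ∣)

    W : ℚ
    W = ∑ (λ v → ∑ (weight v))

  constant : ℚ
  constant = (K ℚ.+ K) ℚ.+ W

  constant≥0 : 0ℚ ℚ.≤ constant
  constant≥0 = 0≤p+q (0≤p+q K≥0 K≥0) (0≤∑ λ v → 0≤∑ (weight≥0 v))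
    where
    K≥0 : 0ℚ ℚ.≤ K
    K≥0 = 0≤∑ λ v → ℚ.0≤∣p∣ (c v)

  module _
    (X : Fin n → Fin n → ℚ) (η : ℚ)
    (X-sym : ∀ v u → X v u ≡ X u v)
    (X≥-η : ∀ v u → 0ℚ ℚ.≤ X v u ℚ.+ η)
    (balanced : ∀ v → ℚ.∣ ∑ (λ u → S v u ℚ.* X v u) ∣ ℚ.≤ η)
    where

    private
      F : Fin n → Fin n → ℚ
      F v u = S v u ℚ.* X v u

      D : ℚ
      D = ∑ (λ v → c v ℚ.* ∑ (F v))

      term : Fin n → Fin n → ℚ
      term v u = weight v u ℚ.* (X v u ℚ.+ η)

      term≥0 : ∀ v u → 0ℚ ℚ.≤ term v u
      term≥0 v u = 0≤p*q (weight≥0 v u) (X≥-η v u)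

      row : ∀ v → ∑ (term v) ≡ ∑ (λ u → (c v ℚ.+ c u) ℚ.* F v u) ℚ.+ ∑ (weight v) ℚ.* η
      row v = begin
        ∑ (term v)
          ≡⟨ sum-cong-≗ (λ u → trans (ℚ.*-distribˡ-+ (weight v u) (X v u) η)
               (cong (ℚ._+ weight v u ℚ.* η) (ℚ.*-assoc (c v ℚ.+ c u) (S v u) (X v u)))) ⟩
        ∑ (λ u → (c v ℚ.+ c u) ℚ.* F v u ℚ.+ weight v u ℚ.* η)
          ≡⟨ ∑-distrib-+ (λ u → (c v ℚ.+ c u) ℚ.* F v u) (λ u → weight v u ℚ.* η) ⟩
        ∑ (λ u → (c v ℚ.+ c u) ℚ.* F v u) ℚ.+ ∑ (λ u → weight v u ℚ.* η)
          ≡⟨ cong (∑ (λ u → (c v ℚ.+ c u) ℚ.* F v u) ℚ.+_) (*-distribʳ-sum η (weight v)) ⟨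
        ∑ (λ u → (c v ℚ.+ c u) ℚ.* F v u) ℚ.+ ∑ (weight v) ℚ.* η ∎
        where open ≡-Reasoning

      D≤Kη : D ℚ.≤ K ℚ.* η
      D≤Kη = ∑-weighted-bound c (λ v → ∑ (F v)) η balanced

    -- After the shift by `η` all terms are nonnegative, so a single one is at most the whole double
    -- sum. That sum consists of `D` twice, each at most `K * η` by near balance, and of `W * η`
    -- from the shift; hence the value of `constant`.
    weighted-bound : ∀ v u → (c v ℚ.+ c u) ℚ.* S v u ℚ.* (X v u ℚ.+ η) ℚ.≤ constant ℚ.* η
    weighted-bound v u = begin
      term v u
        ≤⟨ term≤∑ (term≥0 v) u ⟩
      ∑ (term v)
        ≤⟨ term≤∑ (λ w → 0≤∑ (term≥0 w)) v ⟩
      ∑ (λ w → ∑ (term w))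
        ≡⟨ trans (sum-cong-≗ row)
             (∑-distrib-+ (λ w → ∑ λ z → (c w ℚ.+ c z) ℚ.* F w z) (λ w → ∑ (weight w) ℚ.* η)) ⟩
      ∑ (λ w → ∑ λ z → (c w ℚ.+ c z) ℚ.* F w z) ℚ.+ ∑ (λ w → ∑ (weight w) ℚ.* η)
        ≡⟨ cong₂ ℚ._+_
             (∑-weights-swap c F λ w z → cong₂ ℚ._*_ (S-sym w z) (X-sym w z))
             (sym (*-distribʳ-sum η (λ w → ∑ (weight w)))) ⟩
      (D ℚ.+ D) ℚ.+ W ℚ.* η
        ≤⟨ ℚ.+-monoˡ-≤ (W ℚ.* η) (ℚ.+-mono-≤ D≤Kη D≤Kη) ⟩
      (K ℚ.* η ℚ.+ K ℚ.* η) ℚ.+ W ℚ.* η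
        ≡⟨ solve 3 (λ K W η → (K :* η :+ K :* η) :+ W :* η := ((K :+ K) :+ W) :* η) refl K W η ⟩
      constant ℚ.* η ∎
      where open ℚ.≤-Reasoning

-- Closed walks of length four

-- For distinct `a` and `b` this is the adjacency matrix of the single edge ab.
segment : (a b : Fin n) → Fin n → Fin n → ℚ
segment a b u v = δ a u ℚ.* δ b v ℚ.+ δ b u ℚ.* δ a v

segment-sym : (a b u v : Fin n) → segment a b u v ≡ segment a b v u
segment-sym a b u v = solve 4 (λ p q r s → p :* q :+ r :* s := s :* r :+ q :* p) refl
  (δ a u) (δ b v) (δ b u) (δ a v)

0≤segment : (a b u v : Fin n) → 0ℚ ℚ.≤ segment a b u v
0≤segment a b u v = 0≤p+q
  (0≤p*q (0≤𝟙 (a Fin.≟ u)) (0≤𝟙 (b Fin.≟ v))) (0≤p*q (0≤𝟙 (b Fin.≟ u)) (0≤𝟙 (a Fin.≟ v)))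

1≤segment : (a b : Fin n) → 1ℚ ℚ.≤ segment a b a b
1≤segment a b = begin
  1ℚ                  ≡⟨ cong₂ ℚ._*_ (δ-refl a) (δ-refl b) ⟨
  δ a a ℚ.* δ b b     ≤⟨ p≤p+q {δ b a ℚ.* δ a b} {δ a a ℚ.* δ b b}
                           (0≤p*q (0≤𝟙 (b Fin.≟ a)) (0≤𝟙 (a Fin.≟ b))) ⟩
  segment a b a b     ∎
  where open ℚ.≤-Reasoning

δ-subst : (f : Fin n → ℚ) (a v : Fin n) → δ a v ℚ.* f v ≡ δ a v ℚ.* f a
δ-subst f a v with a Fin.≟ v
... | yes refl = refl
... | no _     = trans (ℚ.*-zeroˡ (f v)) (sym (ℚ.*-zeroˡ (f a)))

∑-segment : (M : Fin n → Fin n → ℚ) (a b v : Fin n) →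
  ∑ (λ u → M v u ℚ.* segment a b v u) ≡ δ a v ℚ.* M a b ℚ.+ δ b v ℚ.* M b a
∑-segment M a b v = begin
  ∑ (λ u → M v u ℚ.* segment a b v u)
    ≡⟨ sum-cong-≗ (λ u → solve 5 (λ m p q r s →
         m :* (p :* q :+ r :* s) := q :* (p :* m) :+ s :* (r :* m)) refl
         (M v u) (δ a v) (δ b u) (δ b v) (δ a u)) ⟩
  ∑ (λ u → δ b u ℚ.* (δ a v ℚ.* M v u) ℚ.+ δ a u ℚ.* (δ b v ℚ.* M v u))
    ≡⟨ ∑-distrib-+ (λ u → δ b u ℚ.* (δ a v ℚ.* M v u)) (λ u → δ a u ℚ.* (δ b v ℚ.* M v u)) ⟩
  ∑ (λ u → δ b u ℚ.* (δ a v ℚ.* M v u)) ℚ.+ ∑ (λ u → δ a u ℚ.* (δ b v ℚ.* M v u))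
    -- `∑-δ` evaluates each sum at one endpoint; `δ-subst` then replaces the row index `v` by the
    -- other endpoint.
    ≡⟨ cong₂ ℚ._+_
         (trans (∑-δ b (λ u → δ a v ℚ.* M v u)) (δ-subst (λ w → M w b) a v))
         (trans (∑-δ a (λ u → δ b v ℚ.* M v u)) (δ-subst (λ w → M w a) b v)) ⟩
  δ a v ℚ.* M a b ℚ.+ δ b v ℚ.* M b a ∎
  where open ≡-Reasoning

module _ (M : Fin n → Fin n → ℚ) (M-sym : ∀ u v → M u v ≡ M v u) {a b : Fin n} (v : Fin n) where

  ∑-segment-1 : M a b ≡ 1ℚ → ∑ (λ u → M v u ℚ.* segment a b v u) ≡ δ a v ℚ.+ δ b v
  ∑-segment-1 eq = trans (∑-segment M a b v) (cong₂ ℚ._+_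
    (trans (cong (δ a v ℚ.*_) eq) (ℚ.*-identityʳ (δ a v)))
    (trans (cong (δ b v ℚ.*_) (trans (M-sym b a) eq)) (ℚ.*-identityʳ (δ b v))))

  ∑-segment-0 : M a b ≡ 0ℚ → ∑ (λ u → M v u ℚ.* segment a b v u) ≡ 0ℚ
  ∑-segment-0 eq = trans (∑-segment M a b v) (cong₂ ℚ._+_
    (trans (cong (δ a v ℚ.*_) eq) (ℚ.*-zeroʳ (δ a v)))
    (trans (cong (δ b v ℚ.*_) (trans (M-sym b a) eq)) (ℚ.*-zeroʳ (δ b v))))

closedWalk : (a b c d : Fin n) → Fin n → Fin n → ℚ
closedWalk a b c d u v =
  (segment a b u v ℚ.+ segment b c u v) ℚ.+ (segment c d u v ℚ.+ segment d a u v)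

closedWalk-sym : (a b c d u v : Fin n) → closedWalk a b c d u v ≡ closedWalk a b c d v u
closedWalk-sym a b c d u v = cong₂ ℚ._+_
  (cong₂ ℚ._+_ (segment-sym a b u v) (segment-sym b c u v))
  (cong₂ ℚ._+_ (segment-sym c d u v) (segment-sym d a u v))

closedWalk-rotate : (a b c d u v : Fin n) → closedWalk a b c d u v ≡ closedWalk b c d a u v
closedWalk-rotate a b c d u v = solve 4 (λ p q r s →
  (p :+ q) :+ (r :+ s) := (q :+ r) :+ (s :+ p)) refl
  (segment a b u v) (segment b c u v) (segment c d u v) (segment d a u v)

0≤closedWalk : (a b c d u v : Fin n) → 0ℚ ℚ.≤ closedWalk a b c d u v
0≤closedWalk a b c d u v = 0≤p+q
  (0≤p+q (0≤segment a b u v) (0≤segment b c u v))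
  (0≤p+q (0≤segment c d u v) (0≤segment d a u v))

1≤closedWalk : (a b c d : Fin n) → 1ℚ ℚ.≤ closedWalk a b c d a b
1≤closedWalk a b c d = begin
  1ℚ
    ≤⟨ 1≤segment a b ⟩
  segment a b a b
    ≤⟨ p≤p+q {segment b c a b} {segment a b a b} (0≤segment b c a b) ⟩
  segment a b a b ℚ.+ segment b c a b
    ≤⟨ p≤p+q {segment c d a b ℚ.+ segment d a a b} {segment a b a b ℚ.+ segment b c a b}
         (0≤p+q (0≤segment c d a b) (0≤segment d a a b)) ⟩
  closedWalk a b c d a b ∎
  where open ℚ.≤-Reasoning

-- Here `M` stands for the indicator of a colour that ab and cd have and bc and da lack. The right
-- side counts the occurrences of `v` on the walk; rotation leaves the count unchanged, so the other
-- colour yields the same value.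
∑-closedWalk : (M : Fin n → Fin n → ℚ) → (∀ u v → M u v ≡ M v u) → ∀ {a b c d} →
  M a b ≡ 1ℚ → M b c ≡ 0ℚ → M c d ≡ 1ℚ → M d a ≡ 0ℚ → ∀ v →
  ∑ (λ u → M v u ℚ.* closedWalk a b c d v u) ≡ (δ a v ℚ.+ δ b v) ℚ.+ (δ c v ℚ.+ δ d v)
∑-closedWalk M M-sym {a} {b} {c} {d} ab bc cd da v = begin
  ∑ (λ u → M v u ℚ.* closedWalk a b c d v u)
    ≡⟨ distrib (λ u → segment a b v u ℚ.+ segment b c v u) (λ u → segment c d v u ℚ.+ segment d a v u) ⟩
  ∑ (λ u → M v u ℚ.* (segment a b v u ℚ.+ segment b c v u)) ℚ.+
  ∑ (λ u → M v u ℚ.* (segment c d v u ℚ.+ segment d a v u))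
    ≡⟨ cong₂ ℚ._+_ (half-walk ab bc) (half-walk cd da) ⟩
  (δ a v ℚ.+ δ b v) ℚ.+ (δ c v ℚ.+ δ d v) ∎
  where
  open ≡-Reasoning
  distrib : (f g : Fin _ → ℚ) → ∑ (λ u → M v u ℚ.* (f u ℚ.+ g u)) ≡
    ∑ (λ u → M v u ℚ.* f u) ℚ.+ ∑ (λ u → M v u ℚ.* g u)
  distrib f g = trans (sum-cong-≗ λ u → ℚ.*-distribˡ-+ (M v u) (f u) (g u))
    (∑-distrib-+ (λ u → M v u ℚ.* f u) (λ u → M v u ℚ.* g u))

  half-walk : ∀ {p q r} → M p q ≡ 1ℚ → M q r ≡ 0ℚ →
    ∑ (λ u → M v u ℚ.* (segment p q v u ℚ.+ segment q r v u)) ≡ δ p v ℚ.+ δ q v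
  half-walk {p} {q} {r} pq qr = begin
    ∑ (λ u → M v u ℚ.* (segment p q v u ℚ.+ segment q r v u))
      ≡⟨ distrib (segment p q v) (segment q r v) ⟩
    ∑ (λ u → M v u ℚ.* segment p q v u) ℚ.+ ∑ (λ u → M v u ℚ.* segment q r v u)
      ≡⟨ cong₂ ℚ._+_ (∑-segment-1 M M-sym v pq) (∑-segment-0 M M-sym v qr) ⟩
    (δ p v ℚ.+ δ q v) ℚ.+ 0ℚ
      ≡⟨ ℚ.+-identityʳ (δ p v ℚ.+ δ q v) ⟩
    δ p v ℚ.+ δ q v ∎

-- Coloured complete graphs

module _ {n : ℕ} where

  -- Either order lists the smaller endpoint first, and irrelevance of the proof fields makes the
  -- two edges definitionally equal.
  joining-sym : (u v : Fin n) .(p : u ≢ v) .(q : v ≢ u) →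
    joining (complete n) u v p ≡ joining (complete n) v u q
  joining-sym u v p q with Fin.<-cmp u v | Fin.<-cmp v u
  ... | tri< u<v _ _   | tri< _ _ u≮v   = contradiction u<v u≮v
  ... | tri< _ _ _     | tri> _ _ _     = refl
  ... | tri> _ _ _     | tri< _ _ _     = refl
  ... | tri> _ _ v<u   | tri> v≮u _ _   = contradiction v<u v≮u
  ... | tri≈ _ u≡v _   | _              = ⊥-elim-irr (p u≡v)
  ... | tri< _ _ _     | tri≈ _ v≡u _   = ⊥-elim-irr (q v≡u)
  ... | tri> _ _ _     | tri≈ _ v≡u _   = ⊥-elim-irr (q v≡u)

  -- An edge vector is turned into a symmetric matrix with zero diagonal, so that sums over incident
  -- edges become row sums.
  entry : ℝ^ Edge (complete n) → Fin n → Fin n → ℝ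
  entry x u v with u Fin.≟ v
  ... | yes _  = 0ℝ
  ... | no u≢v = x (joining (complete n) u v u≢v)

  entry-sym : ∀ x u v → entry x u v ≡ entry x v u
  entry-sym x u v with u Fin.≟ v | v Fin.≟ u
  ... | yes _   | yes _   = refl
  ... | yes u≡v | no v≢u  = contradiction (sym u≡v) v≢u
  ... | no u≢v  | yes v≡u = contradiction (sym v≡u) u≢v
  ... | no u≢v  | no v≢u  = cong x (joining-sym u v u≢v v≢u)

  entry-edge : ∀ x e → entry x (Edge.lo e) (Edge.hi e) ≡ x e
  entry-edge x (edge u v u<v u≢v) with u Fin.≟ v
  ... | yes u≡v = ⊥-elim-irr (u≢v u≡v)
  ... | no  _   with Fin.<-cmp u v
  ...   | tri< _ _ _   = refl
  ...   | tri≈ _ u≡v _ = ⊥-elim-irr (u≢v u≡v)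
  ...   | tri> u≮v _ _ = ⊥-elim-irr (u≮v u<v)

  entry-nonneg : ∀ x → (∀ e → 0ℝ ≤ x e) → ∀ u v → 0ℝ ≤ entry x u v
  entry-nonneg x x≥0 u v with u Fin.≟ v
  ... | no _  = x≥0 _
  ... | yes _ = λ ε 0<ε → 0 , λ _ _ → subst (0ℚ ℚ.<_) (sym (ℚ.+-identityˡ ε)) 0<ε

  null⇒entry-null : ∀ x → x ≋ 0ᵛ → ∀ u v → Null (entry x u v)
  null⇒entry-null x x≃0 u v with u Fin.≟ v
  ... | yes _  = ≗⇒≃ 0ℝ 0ℝ (λ _ → refl)
  ... | no u≢v = x≃0 (joining (complete n) u v u≢v)

  fromWeights : (Fin n → Fin n → ℚ) → ℝ^ Edge (complete n)
  fromWeights W e = fromℚ (W (Edge.lo e) (Edge.hi e))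

  entry-fromWeights : ∀ W → (∀ u v → W u v ≡ W v u) →
    ∀ u v → u ≢ v → entry (fromWeights W) u v ≡ fromℚ (W u v)
  entry-fromWeights W W-sym u v u≢v with u Fin.≟ v
  ... | yes u≡v = contradiction u≡v u≢v
  ... | no  _   with Fin.<-cmp u v
  ...   | tri< _ _ _   = refl
  ...   | tri≈ _ u≡v _ = contradiction u≡v u≢v
  ...   | tri> _ _ _   = cong fromℚ (W-sym v u)

-- Colour indicators and colour sums of a graph

module _ {n : ℕ} (G : SimpleGraph n) where
  open SimpleGraph G

  -- Blue demands distinctness explicitly: a vertex is not adjacent to itself, so the diagonal would
  -- otherwise count as blue.
  HasColour : Colour → Fin n → Fin n → Set
  HasColour red  u v = u ∼ v
  HasColour blue u v = u ≢ v × ¬ u ∼ v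

  hasColour? : ∀ κ u v → Dec (HasColour κ u v)
  hasColour? red  u v = u ∼? v
  hasColour? blue u v = ¬? (u Fin.≟ v) ×-dec ¬? (u ∼? v)

  HasColour-sym : ∀ κ {u v} → HasColour κ u v → HasColour κ v u
  HasColour-sym red  u∼v         = ∼-sym u∼v
  HasColour-sym blue (u≢v , u≁v) = ≢-sym u≢v , u≁v ∘ ∼-sym

  HasColour⇒≢ : ∀ κ {u v} → HasColour κ u v → u ≢ v
  HasColour⇒≢ red  u∼v u≡v = ∼-irrefl u≡v u∼v
  HasColour⇒≢ blue         = proj₁

  ind : Colour → Fin n → Fin n → ℚ
  ind κ u v = 𝟙 (hasColour? κ u v)

  ind-sym : ∀ κ u v → ind κ u v ≡ ind κ v u
  ind-sym κ u v = 𝟙-cong (hasColour? κ u v) (hasColour? κ v u) (HasColour-sym κ) (HasColour-sym κ)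

  ind-true : ∀ κ {u v} → HasColour κ u v → ind κ u v ≡ 1ℚ
  ind-true κ {u} {v} = 𝟙-true (hasColour? κ u v)

  ind-false : ∀ κ {u v} → ¬ HasColour κ u v → ind κ u v ≡ 0ℚ
  ind-false κ {u} {v} = 𝟙-false (hasColour? κ u v)

  ind-diag : ∀ κ v → ind κ v v ≡ 0ℚ
  ind-diag κ v = ind-false κ λ h → HasColour⇒≢ κ h refl

  -- `adjacencyColour` tests the endpoints in increasing order, so the case where `v` is the smaller
  -- one goes through the symmetry of adjacency.
  colour-red : ∀ {u v} .(u≢v : u ≢ v) → u ∼ v →
    adjacencyColour G (joining (complete n) u v u≢v) ≡ red
  colour-red {u} {v} u≢v u∼v with Fin.<-cmp u v
  ... | tri≈ _ u≡v _ = ⊥-elim-irr (u≢v u≡v)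
  ... | tri< _ _ _ with u ∼? v
  ...   | yes _  = refl
  ...   | no u≁v = contradiction u∼v u≁v
  colour-red {u} {v} u≢v u∼v | tri> _ _ _ with v ∼? u
  ...   | yes _  = refl
  ...   | no v≁u = contradiction (∼-sym u∼v) v≁u

  colour-blue : ∀ {u v} .(u≢v : u ≢ v) → ¬ u ∼ v →
    adjacencyColour G (joining (complete n) u v u≢v) ≡ blue
  colour-blue {u} {v} u≢v u≁v with Fin.<-cmp u v
  ... | tri≈ _ u≡v _ = ⊥-elim-irr (u≢v u≡v)
  ... | tri< _ _ _ with u ∼? v
  ...   | yes u∼v = contradiction u∼v u≁v
  ...   | no _    = refl
  colour-blue {u} {v} u≢v u≁v | tri> _ _ _ with v ∼? u
  ...   | yes v∼u = contradiction (∼-sym v∼u) u≁v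
  ...   | no _    = refl

  seq-keepIf : ∀ κ {κ′} r {u v} → HasColour κ′ u v →
    ∀ k → seq (keepIf κ κ′ r) k ≡ ind κ u v ℚ.* seq r k
  seq-keepIf κ r {u} {v} h k = lemma κ _ h
    where
    keep : ∀ κ → HasColour κ u v → seq r k ≡ ind κ u v ℚ.* seq r k
    keep κ h = sym (trans (cong (ℚ._* seq r k) (ind-true κ h)) (ℚ.*-identityˡ (seq r k)))

    drop : ∀ κ → ¬ HasColour κ u v → 0ℚ ≡ ind κ u v ℚ.* seq r k
    drop κ ¬h = sym (trans (cong (ℚ._* seq r k) (ind-false κ ¬h)) (ℚ.*-zeroˡ (seq r k)))

    lemma : ∀ κ κ′ → HasColour κ′ u v → seq (keepIf κ κ′ r) k ≡ ind κ u v ℚ.* seq r k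
    lemma red  red  h = keep red h
    lemma blue blue h = keep blue h
    lemma red  blue h = drop red (proj₂ h)
    lemma blue red  h = drop blue λ h′ → proj₂ h′ h

  seq-colouredValue : ∀ κ x v u k →
    -- The comparison below unfolds both sides at once: `entry` branches on it, and adjacency in
    -- `complete n` is decided by its negation.
    seq (colouredValue (associated G) κ x v u) k ≡ ind κ v u ℚ.* seq (entry x v u) k
  seq-colouredValue κ x v u k with v Fin.≟ u
  ... | yes refl = sym (ℚ.*-zeroʳ (ind κ v v))
  ... | no v≢u   with v ∼? u
  ...   | yes v∼u rewrite colour-red v≢u v∼u = seq-keepIf κ {red} _ v∼u k
  ...   | no v≁u  rewrite colour-blue v≢u v≁u = seq-keepIf κ {blue} _ (v≢u , v≁u) k

  seq-colourSum : ∀ κ x v k →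
    seq (colourSum (associated G) κ x v) k ≡ ∑ (λ u → ind κ v u ℚ.* seq (entry x v u) k)
  seq-colourSum κ x v k = trans (seq-sum (colouredValue (associated G) κ x v) k)
    (sum-cong-≗ λ u → seq-colouredValue κ x v u k)

  coneNull : Set
  coneNull = ∀ x → AlternatingCone (associated G) x → x ≋ 0ᵛ

  -- From threshold weights to a trivial cone

  Separates : (Fin n → ℚ) → Set
  Separates c = ∀ u v → u ≢ v →
    (u ∼ v → 0ℚ ℚ.< c u ℚ.+ c v) × (¬ u ∼ v → c u ℚ.+ c v ℚ.< 0ℚ)

  -- Each strict inequality between reals holds with a positive gap from some index on. The
  -- approximations of the weights at an index `N` common to all pairs therefore separate already.
  rational-weights : IsThreshold G → ∃[ c ] Separates c
  rational-weights (c , separates) =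
    let N , h = eventually-∀ λ u → eventually-∀ λ v → eventual u v
    in (λ v → seq (c v) N) , h N ℕ.≤-refl
    where
    eventual : ∀ u v → Eventually λ k → u ≢ v →
      (u ∼ v → 0ℚ ℚ.< seq (c u) k ℚ.+ seq (c v) k) ×
      (¬ u ∼ v → seq (c u) k ℚ.+ seq (c v) k ℚ.< 0ℚ)
    -- Equality and adjacency are decided here because the index has to be fixed before proofs of
    -- `u ≢ v` and `u ∼ v` are supplied.
    eventual u v with u Fin.≟ v | u ∼? v
    ... | yes u≡v | _ = 0 , λ _ _ u≢v → contradiction u≡v u≢v
    ... | no u≢v | yes u∼v =
      let ε , 0<ε , N , h = proj₁ (separates u v u≢v) u∼v
      in N , λ k N≤k _ →
        (λ _ → ℚ.<-trans 0<ε (subst (ℚ._< _) (ℚ.+-identityˡ ε) (h k N≤k))) ,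
        contradiction u∼v
    ... | no u≢v | no u≁v =
      let ε , 0<ε , N , h = proj₂ (separates u v u≢v) u≁v
      in N , λ k N≤k _ →
        (λ u∼v → contradiction u∼v u≁v) ,
        λ _ → ℚ.≤-<-trans (p≤p+q (ℚ.<⇒≤ 0<ε)) (h k N≤k)

  -- This is the negative of the Seidel matrix of `G`: 1 on red pairs, -1 on blue pairs, 0 on the
  -- diagonal.
  signs : Fin n → Fin n → ℚ
  signs u v = ind red u v ℚ.- ind blue u v

  signs-sym : ∀ u v → signs u v ≡ signs v u
  signs-sym u v = cong₂ ℚ._-_ (ind-sym red u v) (ind-sym blue u v)

  signs-diag : ∀ v → signs v v ≡ 0ℚ
  signs-diag v = cong₂ ℚ._-_ (ind-diag red v) (ind-diag blue v)

  signs-red : ∀ {u v} → u ∼ v → signs u v ≡ 1ℚ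
  signs-red u∼v = cong₂ ℚ._-_ (ind-true red u∼v) (ind-false blue λ h → proj₂ h u∼v)

  signs-blue : ∀ {u v} → u ≢ v → ¬ u ∼ v → signs u v ≡ ℚ.- 1ℚ
  signs-blue u≢v u≁v = cong₂ ℚ._-_ (ind-false red u≁v) (ind-true blue (u≢v , u≁v))

  seq-balance : ∀ x v k → ∑ (λ u → signs v u ℚ.* seq (entry x v u) k) ≡
    seq (colourSum (associated G) red x v) k ℚ.- seq (colourSum (associated G) blue x v) k
  seq-balance x v k = begin
    ∑ (λ u → signs v u ℚ.* X u)
      ≡⟨ solve 2 (λ a b → a := (a :+ b) :- b) refl (∑ (λ u → signs v u ℚ.* X u)) (∑ blues) ⟩
    (∑ (λ u → signs v u ℚ.* X u) ℚ.+ ∑ blues) ℚ.- ∑ blues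
      ≡⟨ cong (ℚ._- ∑ blues) (trans (sym (∑-distrib-+ (λ u → signs v u ℚ.* X u) blues))
           (sum-cong-≗ λ u → solve 3 (λ r b y → (r :- b) :* y :+ b :* y := r :* y) refl
             (ind red v u) (ind blue v u) (X u))) ⟩
    ∑ (λ u → ind red v u ℚ.* X u) ℚ.- ∑ blues
      ≡⟨ cong₂ ℚ._-_ (seq-colourSum red x v k) (seq-colourSum blue x v k) ⟨
    seq (colourSum (associated G) red x v) k ℚ.- seq (colourSum (associated G) blue x v) k ∎
    where
    open ≡-Reasoning
    X blues : Fin n → ℚ
    X u = seq (entry x v u) k
    blues u = ind blue v u ℚ.* X u

  module _ (c : Fin n → ℚ) (separates : Separates c) where

    -- For separating weights `signs u v` is the sign of `c u + c v`, so the product is the absolute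
    -- value of that sum.
    weight>0 : ∀ u v → u ≢ v → 0ℚ ℚ.< (c u ℚ.+ c v) ℚ.* signs u v
    weight>0 u v u≢v = lemma (u ∼? v)
      where
      lemma : Dec (u ∼ v) → 0ℚ ℚ.< (c u ℚ.+ c v) ℚ.* signs u v
      lemma (yes u∼v) = subst (0ℚ ℚ.<_)
        (sym (trans (cong ((c u ℚ.+ c v) ℚ.*_) (signs-red u∼v)) (ℚ.*-identityʳ (c u ℚ.+ c v))))
        (proj₁ (separates u v u≢v) u∼v)
      lemma (no u≁v) = subst (0ℚ ℚ.<_)
        (trans (solve 1 (λ a → :- a := a :* con (ℚ.- 1ℚ)) refl (c u ℚ.+ c v))
          (cong ((c u ℚ.+ c v) ℚ.*_) (sym (signs-blue u≢v u≁v))))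
        (ℚ.neg-antimono-< (proj₂ (separates u v u≢v) u≁v))

    weight≥0 : ∀ u v → 0ℚ ℚ.≤ (c u ℚ.+ c v) ℚ.* signs u v
    weight≥0 u v = lemma (u Fin.≟ v)
      where
      lemma : Dec (u ≡ v) → 0ℚ ℚ.≤ (c u ℚ.+ c v) ℚ.* signs u v
      lemma (no u≢v)   = ℚ.<⇒≤ (weight>0 u v u≢v)
      lemma (yes refl) = ℚ.≤-reflexive
        (sym (trans (cong ((c u ℚ.+ c u) ℚ.*_) (signs-diag u)) (ℚ.*-zeroʳ (c u ℚ.+ c u))))

    open Potential c signs signs-sym weight≥0

    -- At late indices all entries exceed `- η` and all balances are within `η` of 0. Then
    -- `weighted-bound` gives `m * (X u v + η) ≤ constant * η < m * ε`, which bounds the entry from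
    -- above; from below it exceeds `- η`, hence `- ε`.
    entry-null : ∀ x → AlternatingCone (associated G) x → ∀ u v → u ≢ v → Null (entry x u v)
    entry-null x (x≥0 , balanced) u v u≢v ε 0<ε = eventually-map
      (λ k (nonneg , balanced) → small k nonneg balanced)
      (eventually-×
        (eventually-∀ λ w → eventually-∀ λ z → entry-nonneg x x≥0 w z η 0<η)
        (eventually-∀ λ w → balanced w η 0<η))
      where
      m : ℚ
      m = (c u ℚ.+ c v) ℚ.* signs u v
      m>0 : 0ℚ ℚ.< m
      m>0 = weight>0 u v u≢v
      -- Adding `m` to `constant` keeps the divisor positive, makes the upper bound strict, and
      -- yields `η ≤ ε` from `m * η ≤ M * η = m * ε`.
      M : ℚ
      M = constant ℚ.+ m
      M>0 : 0ℚ ℚ.< M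
      M>0 = ℚ.<-≤-trans m>0 (p≤q+p constant≥0)
      division : ∃[ η ] 0ℚ ℚ.< η × M ℚ.* η ≡ m ℚ.* ε
      division = divideℚ M (ℚ.positive M>0) (m ℚ.* ε) (0<p*q m>0 0<ε)
      η : ℚ
      η = proj₁ division
      0<η : 0ℚ ℚ.< η
      0<η = proj₁ (proj₂ division)
      Mη≡mε : M ℚ.* η ≡ m ℚ.* ε
      Mη≡mε = proj₂ (proj₂ division)
      η≤ε : η ℚ.≤ ε
      η≤ε = ℚ.*-cancelˡ-≤-pos m {{ℚ.positive m>0}} (subst (m ℚ.* η ℚ.≤_) Mη≡mε
        (ℚ.*-monoʳ-≤-nonNeg η {{ℚ.nonNegative (ℚ.<⇒≤ 0<η)}} (p≤q+p constant≥0)))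

      small : ∀ k → (∀ w z → 0ℚ ℚ.< seq (entry x w z) k ℚ.+ η) →
        (∀ w → ℚ.∣ seq (colourSum (associated G) red x w) k
             ℚ.- seq (colourSum (associated G) blue x w) k ∣ ℚ.< η) →
        ℚ.∣ seq (entry x u v) k ℚ.- 0ℚ ∣ ℚ.< ε
      small k nonneg balanced = subst (ℚ._< ε)
        (cong ℚ.∣_∣ (sym (ℚ.+-identityʳ (X u v))))
        (∣p∣<q
          (ℚ.≤-<-trans (ℚ.neg-antimono-≤ η≤ε)
            (subst₂ ℚ._<_ (ℚ.+-identityˡ (ℚ.- η))
              (solve 2 (λ a b → (a :+ b) :- b := a) refl (X u v) η)
              (ℚ.+-monoˡ-< (ℚ.- η) (nonneg u v))))
          (ℚ.≤-<-trans (p≤p+q (ℚ.<⇒≤ 0<η)) X+η<ε))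
        where
        X : Fin n → Fin n → ℚ
        X w z = seq (entry x w z) k

        X+η<ε : X u v ℚ.+ η ℚ.< ε
        X+η<ε = ℚ.*-cancelˡ-<-nonNeg m {{ℚ.nonNegative (ℚ.<⇒≤ m>0)}} (begin-strict
          m ℚ.* (X u v ℚ.+ η)
            ≤⟨ weighted-bound X η (λ w z → cong (λ y → seq y k) (entry-sym x w z))
                 (λ w z → ℚ.<⇒≤ (nonneg w z))
                 (λ w → ℚ.<⇒≤ (subst (ℚ._< η) (cong ℚ.∣_∣ (sym (seq-balance x w k))) (balanced w)))
                 u v ⟩
          constant ℚ.* η
            <⟨ ℚ.*-monoˡ-<-pos η {{ℚ.positive 0<η}}
                 (subst (ℚ._< M) (ℚ.+-identityʳ constant) (ℚ.+-monoʳ-< constant m>0)) ⟩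
          M ℚ.* η
            ≡⟨ Mη≡mε ⟩
          m ℚ.* ε ∎)
          where open ℚ.≤-Reasoning

  threshold⇒coneNull : IsThreshold G → coneNull
  threshold⇒coneNull threshold x x∈cone e@(edge u v u<v _) =
    subst Null (entry-edge x e)
      (entry-null (proj₁ weights) (proj₂ weights) x x∈cone u v λ u≡v → ⊥-elim-irr (ℕ.<-irrefl (cong Fin.toℕ u≡v) u<v))
    where weights = rational-weights threshold

  -- From a trivial cone to threshold weights

  -- Such a cycle has four distinct vertices and, according to the pairs ac and bd, induces 2K₂, P₄
  -- or C₄: these are the classical forbidden subgraphs of threshold graphs.
  NoAlternatingCycle : Set
  NoAlternatingCycle = ∀ {a b c d} → a ∼ b → HasColour blue b c → c ∼ d → ¬ HasColour blue d a

  seq-colourSum-fromWeights : ∀ κ W → (∀ u v → W u v ≡ W v u) → ∀ v k →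
    seq (colourSum (associated G) κ (fromWeights W) v) k ≡ ∑ (λ u → ind κ v u ℚ.* W v u)
  seq-colourSum-fromWeights κ W W-sym v k =
    trans (seq-colourSum κ (fromWeights W) v k) (sum-cong-≗ λ u → term u (v Fin.≟ u))
    where
    term : ∀ u → Dec (v ≡ u) →
      ind κ v u ℚ.* seq (entry (fromWeights W) v u) k ≡ ind κ v u ℚ.* W v u
    term u (no v≢u)   = cong (λ y → ind κ v u ℚ.* seq y k) (entry-fromWeights W W-sym v u v≢u)
    -- On the diagonal `entry` is 0 whereas `W v v` is arbitrary; the factor `ind κ v v` annihilates
    -- both.
    term u (yes refl) = trans (vanish (seq (entry (fromWeights W) v v) k)) (sym (vanish (W v v)))
      where
      vanish : ∀ y → ind κ v v ℚ.* y ≡ 0ℚ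
      vanish y = trans (cong (ℚ._* y) (ind-diag κ v)) (ℚ.*-zeroˡ y)

  -- Every visit of the walk to a vertex uses one red and one blue segment, so both colour sums
  -- count the visits.
  closedWalk∈cone : ∀ {a b c d} → a ∼ b → HasColour blue b c → c ∼ d → HasColour blue d a →
    AlternatingCone (associated G) (fromWeights (closedWalk a b c d))
  closedWalk∈cone {a} {b} {c} {d} ab bc cd da =
    (λ e ε 0<ε → 0 , λ _ _ → ℚ.<-≤-trans 0<ε
      (p≤q+p (0≤closedWalk a b c d (Edge.lo e) (Edge.hi e)))) ,
    λ v → ≗⇒≃ (colourSum (associated G) red x v) (colourSum (associated G) blue x v) (balance v)
    where
    open ≡-Reasoning
    W : Fin n → Fin n → ℚ
    W = closedWalk a b c d

    x : ℝ^ Edge (complete n)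
    x = fromWeights W

    notRed : ∀ {u v} → HasColour blue u v → ind red u v ≡ 0ℚ
    notRed h = ind-false red (proj₂ h)

    notBlue : ∀ {u v} → u ∼ v → ind blue u v ≡ 0ℚ
    notBlue u∼v = ind-false blue λ h → proj₂ h u∼v

    balance : ∀ v k → seq (colourSum (associated G) red x v) k ≡ seq (colourSum (associated G) blue x v) k
    balance v k = begin
      seq (colourSum (associated G) red x v) k
        ≡⟨ seq-colourSum-fromWeights red W (closedWalk-sym a b c d) v k ⟩
      ∑ (λ u → ind red v u ℚ.* W v u)
        ≡⟨ ∑-closedWalk (ind red) (ind-sym red)
             (ind-true red ab) (notRed bc) (ind-true red cd) (notRed da) v ⟩
      (δ a v ℚ.+ δ b v) ℚ.+ (δ c v ℚ.+ δ d v)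
        -- Rotating the walk by one vertex puts a blue segment first, the form in which
        -- `∑-closedWalk` applies to blue.
        ≡⟨ solve 4 (λ p q r s → (p :+ q) :+ (r :+ s) := (q :+ r) :+ (s :+ p)) refl
             (δ a v) (δ b v) (δ c v) (δ d v) ⟩
      (δ b v ℚ.+ δ c v) ℚ.+ (δ d v ℚ.+ δ a v)
        ≡⟨ ∑-closedWalk (ind blue) (ind-sym blue)
             (ind-true blue bc) (notBlue cd) (ind-true blue da) (notBlue ab) v ⟨
      ∑ (λ u → ind blue v u ℚ.* closedWalk b c d a v u)
        ≡⟨ sum-cong-≗ (λ u → cong (ind blue v u ℚ.*_) (closedWalk-rotate a b c d v u)) ⟨
      ∑ (λ u → ind blue v u ℚ.* W v u)
        ≡⟨ seq-colourSum-fromWeights blue W (closedWalk-sym a b c d) v k ⟨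
      seq (colourSum (associated G) blue x v) k ∎

  -- The walk vector lies in the cone, yet its entry at ab is a constant that is at least 1.
  coneNull⇒noAlternatingCycle : coneNull → NoAlternatingCycle
  coneNull⇒noAlternatingCycle null {a} {b} {c} {d} ab bc cd da =
    ℚ.<-irrefl {1ℚ} refl
      (ℚ.≤-<-trans (1≤closedWalk a b c d) (fromℚ-null⇒< (W a b) fromWeights≃0 (ℚ.positive⁻¹ 1ℚ)))
    where
    W : Fin n → Fin n → ℚ
    W = closedWalk a b c d

    a≢b : a ≢ b
    a≢b = HasColour⇒≢ red ab

    fromWeights≃0 : Null (fromℚ (W a b))
    fromWeights≃0 = subst Null (entry-fromWeights W (closedWalk-sym a b c d) a b a≢b)
      (null⇒entry-null (fromWeights W) (null (fromWeights W) (closedWalk∈cone ab bc cd da)) a b)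

  -- Degrees and threshold weights

  degree : Fin n → ℚ
  degree u = ∑ (ind red u)

  module _ (noCycle : NoAlternatingCycle) where

    -- Every neighbour of u other than w is a neighbour of w, or u v w z would be
    -- an alternating cycle; adding the entry (u, w) to both rows, at opposite
    -- diagonal positions, makes up for the missing loops.
    degree-gap : ∀ {u v w} → HasColour blue u v → v ∼ w → 1ℚ ℚ.+ degree u ℚ.≤ degree w
    degree-gap {u} {v} {w} (u≢v , u≁v) v∼w = cancel (begin
      (1ℚ ℚ.+ degree u) ℚ.+ e
        ≡⟨ ℚ.+-assoc 1ℚ (degree u) e ⟩
      1ℚ ℚ.+ (degree u ℚ.+ e)
        ≡⟨ cong (1ℚ ℚ.+_) (extended u) ⟨
      1ℚ ℚ.+ ∑ (extend u)
        ≤⟨ ∑-mono-gap (λ z → row-mono z (u Fin.≟ z) (w Fin.≟ z)) v 1ℚ gap ⟩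
      ∑ (extend w)
        ≡⟨ extended w ⟩
      degree w ℚ.+ e ∎)
      where
      open ℚ.≤-Reasoning
      e : ℚ
      e = ind red u w

      extend : Fin n → Fin n → ℚ
      extend y z = ind red y z ℚ.+ δ y z ℚ.* e

      extended : ∀ y → ∑ (extend y) ≡ degree y ℚ.+ e
      extended y = trans (∑-distrib-+ (ind red y) (λ z → δ y z ℚ.* e))
        (cong (degree y ℚ.+_) (∑-δ y (λ _ → e)))

      cancel : ∀ {p q} → p ℚ.+ e ℚ.≤ q ℚ.+ e → p ℚ.≤ q
      cancel {p} {q} h = subst₂ ℚ._≤_ (undo p) (undo q) (ℚ.+-monoˡ-≤ (ℚ.- e) h)
        where
        undo : ∀ p → (p ℚ.+ e) ℚ.- e ≡ p
        undo p = solve 2 (λ a b → (a :+ b) :- b := a) refl p e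

      extend-self : ∀ y → extend y y ≡ e
      extend-self y = trans (cong₂ (λ p q → p ℚ.+ q ℚ.* e) (ind-diag red y) (δ-refl y))
        (trans (ℚ.+-identityˡ (1ℚ ℚ.* e)) (ℚ.*-identityˡ e))

      extend-other : ∀ {y z} → y ≢ z → extend y z ≡ ind red y z
      extend-other {y} {z} y≢z = trans (cong (λ q → ind red y z ℚ.+ q ℚ.* e) (δ-≢ y≢z))
        (trans (cong (ind red y z ℚ.+_) (ℚ.*-zeroˡ e)) (ℚ.+-identityʳ (ind red y z)))

      u≢w : u ≢ w
      u≢w refl = u≁v (∼-sym v∼w)

      neighbour : ∀ {z} → w ≢ z → u ∼ z → w ∼ z
      neighbour {z} w≢z u∼z with w ∼? z
      ... | yes w∼z = w∼z
      ... | no w≁z  = contradiction (≢-sym w≢z , w≁z ∘ ∼-sym)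
        (noCycle (∼-sym v∼w) (≢-sym u≢v , u≁v ∘ ∼-sym) u∼z)

      row-mono : ∀ z → Dec (u ≡ z) → Dec (w ≡ z) → extend u z ℚ.≤ extend w z
      row-mono z (yes refl) _ = ℚ.≤-reflexive (trans (extend-self u)
        (trans (ind-sym red u w) (sym (extend-other (≢-sym u≢w)))))
      row-mono z (no u≢z) (yes refl) = ℚ.≤-reflexive (trans (extend-other u≢w) (sym (extend-self w)))
      row-mono z (no u≢z) (no w≢z)   = subst₂ ℚ._≤_ (sym (extend-other u≢z)) (sym (extend-other w≢z))
        (𝟙-mono (u ∼? z) (w ∼? z) (neighbour w≢z))

      gap : 1ℚ ℚ.+ extend u v ℚ.≤ extend w v
      gap = ℚ.≤-reflexive (trans
        (cong (1ℚ ℚ.+_) (trans (extend-other u≢v) (ind-false red u≁v)))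
        (sym (trans (extend-other (≢-sym (HasColour⇒≢ red v∼w))) (ind-true red (∼-sym v∼w)))))

    -- Vertices `u` that are not non-neighbours of `v` contribute the default 0, which is harmless
    -- in `cutoff-red` because degrees are nonnegative.
    candidate : Fin n → Fin n → ℚ
    candidate v u = if does (hasColour? blue u v) then 1ℚ ℚ.+ degree u else 0ℚ

    cutoff : Fin n → ℚ
    cutoff v = proj₁ (supremum (candidate v))

    cutoff-blue : ∀ {u v} → HasColour blue u v → 1ℚ ℚ.+ degree u ℚ.≤ cutoff v
    cutoff-blue {u} {v} h = subst (ℚ._≤ cutoff v)
      (cong (if_then 1ℚ ℚ.+ degree u else 0ℚ) (dec-true (hasColour? blue u v) h))
      (proj₁ (proj₂ (supremum (candidate v))) u)

    0≤degree : ∀ u → 0ℚ ℚ.≤ degree u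
    0≤degree u = 0≤∑ λ v → 0≤𝟙 (u ∼? v)

    -- By `degree-gap`, each non-neighbour of `v` has degree at least one below that of the
    -- neighbour `w`, so `degree w` bounds all candidates.
    cutoff-red : ∀ {v w} → v ∼ w → cutoff v ℚ.≤ degree w
    cutoff-red {v} {w} v∼w = proj₂ (proj₂ (supremum (candidate v))) (0≤degree w)
      λ u → lemma u (hasColour? blue u v)
      where
      lemma : ∀ u (d : Dec (HasColour blue u v)) →
        (if does d then 1ℚ ℚ.+ degree u else 0ℚ) ℚ.≤ degree w
      lemma u (yes h) = degree-gap h v∼w
      lemma u (no _)  = 0≤degree w

    -- In a sum of two weights, the degree of each vertex pairs with the cutoff of the other. Both
    -- differences are at least 0 on red pairs and at most -1 on blue ones; the two halves add 1 and
    -- centre the ranges, giving at least 1 or at most -1.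
    weightOf : Fin n → ℚ
    weightOf v = (degree v ℚ.- cutoff v) ℚ.+ ½

    weightOf-+ : ∀ u v → weightOf u ℚ.+ weightOf v ≡
      ((degree u ℚ.- cutoff v) ℚ.+ (degree v ℚ.- cutoff u)) ℚ.+ 1ℚ
    weightOf-+ u v = solve 4 (λ p q r s →
      ((p :- q) :+ con ½) :+ ((r :- s) :+ con ½) := ((p :- s) :+ (r :- q)) :+ con 1ℚ) refl
      (degree u) (cutoff u) (degree v) (cutoff v)

    weightOf-red : ∀ {u v} → u ∼ v → 1ℚ ℚ.≤ weightOf u ℚ.+ weightOf v
    weightOf-red {u} {v} u∼v = begin
      (0ℚ ℚ.+ 0ℚ) ℚ.+ 1ℚ
        ≤⟨ ℚ.+-monoˡ-≤ 1ℚ (ℚ.+-mono-≤ (nonneg (∼-sym u∼v)) (nonneg u∼v)) ⟩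
      ((degree u ℚ.- cutoff v) ℚ.+ (degree v ℚ.- cutoff u)) ℚ.+ 1ℚ
        ≡⟨ weightOf-+ u v ⟨
      weightOf u ℚ.+ weightOf v ∎
      where
      open ℚ.≤-Reasoning
      nonneg : ∀ {v w} → v ∼ w → 0ℚ ℚ.≤ degree w ℚ.- cutoff v
      nonneg {v} {w} v∼w = subst (ℚ._≤ degree w ℚ.- cutoff v) (ℚ.+-inverseʳ (cutoff v))
        (ℚ.+-monoˡ-≤ (ℚ.- cutoff v) (cutoff-red v∼w))

    weightOf-blue : ∀ {u v} → HasColour blue u v → weightOf u ℚ.+ weightOf v ℚ.≤ ℚ.- 1ℚ
    weightOf-blue {u} {v} h = begin
      weightOf u ℚ.+ weightOf v
        ≡⟨ weightOf-+ u v ⟩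
      ((degree u ℚ.- cutoff v) ℚ.+ (degree v ℚ.- cutoff u)) ℚ.+ 1ℚ
        ≤⟨ ℚ.+-monoˡ-≤ 1ℚ (ℚ.+-mono-≤ (≤-1 h) (≤-1 (HasColour-sym blue h))) ⟩
      (ℚ.- 1ℚ ℚ.+ ℚ.- 1ℚ) ℚ.+ 1ℚ ∎
      where
      open ℚ.≤-Reasoning
      ≤-1 : ∀ {u v} → HasColour blue u v → degree u ℚ.- cutoff v ℚ.≤ ℚ.- 1ℚ
      ≤-1 {u} {v} h = subst₂ ℚ._≤_
        (solve 2 (λ p q → (con 1ℚ :+ p) :+ (:- con 1ℚ :- q) := p :- q) refl (degree u) (cutoff v))
        (solve 1 (λ q → q :+ (:- con 1ℚ :- q) := :- con 1ℚ) refl (cutoff v))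
        (ℚ.+-monoˡ-≤ (ℚ.- 1ℚ ℚ.- cutoff v) (cutoff-blue h))

    noAlternatingCycle⇒threshold : IsThreshold G
    noAlternatingCycle⇒threshold = fromℚ ∘ weightOf , λ u v u≢v →
      -- The sums are at distance at least 1 from 0, so the gap ½ is available from index 0 on in
      -- both cases.
      (λ u∼v → ½ , ℚ.positive⁻¹ ½ , 0 , λ _ _ →
        ℚ.<-≤-trans (from-yes (0ℚ ℚ.+ ½ ℚ.<? 1ℚ)) (weightOf-red u∼v)) ,
      (λ u≁v → ½ , ℚ.positive⁻¹ ½ , 0 , λ _ _ →
        ℚ.≤-<-trans (ℚ.+-monoˡ-≤ ½ (weightOf-blue (u≢v , u≁v))) (from-yes (ℚ.- 1ℚ ℚ.+ ½ ℚ.<? 0ℚ)))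

theorem2p1 : (n : ℕ) (G : SimpleGraph n) →
    IsThreshold G ⇔ ConeDimension (AlternatingCone (associated G)) 0
theorem2p1 n G = mk⇔
  (λ threshold → null⇒dimension-zero (threshold⇒coneNull G threshold))
  (λ dim → noAlternatingCycle⇒threshold G
    (coneNull⇒noAlternatingCycle G (dimension-zero⇒null dim)))
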